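{- Let $S$ be a solid and let $x,y\in S$. If $x$ and $y$ are both positive, i.e. $e(x)\le x$ and $e(y)\le y$, then $e(xy)\le xy$.
   Context: A solid is a set $S$ with binary operations $+$ and $\cdot$ and a relation $\le$ satisfying: (1) $+$ is associative and commutative; for every $x$ there is a unique $e$ with $x+e=x$ and $e+f=e$ whenever $x+f=x$, written $e(x)$ (the magnitude of $x$); for every $x$ there is $s$ with $x+s=e(x)$ and $e(s)=e(x)$, written $-x$; $e(x+y)=e(x)$ or $e(x+y)=e(y)$. (2) $\cdot$ is associative and commutative; for every $x\ne e(x)$ there is a unique $u$ with $xu=x$ and $uv=u$ whenever $xv=x$, written $u(x)$; for every $x\ne e(x)$ there is $d$ with $xd=u(x)$ and $u(d)=u(x)$, written $x^{ -1}$; for $x\ne e(x),y\ne e(y)$: $u(xy)=u(x)$ or $u(xy)=u(y)$. (3) $\le$ is a total order; $x\le y\Rightarrow x+z\le y+z$; $y+e(x)=e(x)\Rightarrow (y\le e(x)$ and $-y\le e(x))$; $(e(x)<x$ and $y\le z)\Rightarrow xy\le xz$; $e(y)\le y\le z\Rightarrow e(x)y\le e(x)z$. (4) For all $x,y$ there is $z$ with $e(x)y=e(z)$; $e(xy)=e(x)y+e(y)x$; for $x\ne e(x)$, $e(u(x))=e(x)x^{ -1}$; $xy+xz=x(y+z)+e(x)y+e(x)z$; $-(xy)=(-x)y$. (5) There is $0$ with $0+x=x$ for all $x$; there is $1$ with $1x=x$ for all $x$; there is $M$ with $e(x)+M=M$ for all $x$; there is $x$ with $e(x)\ne 0$ and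 $e(x)\ne M$; for every $x$ there is $a$ with $x=a+e(x)$ and $e(a)=0$; if $x=e(x)$, $y=e(y)$ and $x<y$ then there is $z\ne e(z)$ with $x<z<y$. -}

module Defs where

open import Data.Product using (Σ; ∃; _×_)
open import Data.Sum using (_⊎_)
open import Relation.Binary.PropositionalEquality using (_≡_; _≢_)
open import Relation.Binary.Structures using (IsTotalOrder)

-- A solid, with the axioms (1)-(5) of the paper.  The magnitude e(x) and
-- unity u(x) are given as operations together with their defining
-- property and its uniqueness; -x and x⁻¹ are given as (choice) operations
-- satisfying their defining properties.
record Solid : Set₁ where
  infixl 6 _+_
  infixl 7 _·_
  infix 4 _≤_ _<_
  infix 8 -_
  field
    Carrier : Set
    _+_ _·_ : Carrier → Carrier → Carrier
    _≤_ : Carrier → Carrier → Set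
    e : Carrier → Carrier
    -_ : Carrier → Carrier
    u : (x : Carrier) → x ≢ e x → Carrier
    inv : (x : Carrier) → x ≢ e x → Carrier
    𝟘 𝟙 M : Carrier

  _<_ : Carrier → Carrier → Set
  x < y = x ≤ y × x ≢ y

  field
    +-assoc : ∀ x y z → (x + y) + z ≡ x + (y + z)
    +-comm : ∀ x y → x + y ≡ y + x
    e-neutral : ∀ x → x + e x ≡ x
    e-minimal : ∀ x f → x + f ≡ x → e x + f ≡ e x
    e-unique : ∀ x e′ → x + e′ ≡ x → (∀ f → x + f ≡ x → e′ + f ≡ e′) → e′ ≡ e x
    neg-inverse : ∀ x → x + (- x) ≡ e x
    neg-magnitude : ∀ x → e (- x) ≡ e x
    e-sum : ∀ x y → e (x + y) ≡ e x ⊎ e (x + y) ≡ e y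
    ·-assoc : ∀ x y z → (x · y) · z ≡ x · (y · z)
    ·-comm : ∀ x y → x · y ≡ y · x
    u-neutral : ∀ x (p : x ≢ e x) → x · u x p ≡ x
    u-minimal : ∀ x (p : x ≢ e x) v → x · v ≡ x → u x p · v ≡ u x p
    u-unique : ∀ x (p : x ≢ e x) u′ → x · u′ ≡ x → (∀ v → x · v ≡ x → u′ · v ≡ u′) → u′ ≡ u x p
    inv-inverse : ∀ x (p : x ≢ e x) → x · inv x p ≡ u x p
    inv-unity : ∀ x (p : x ≢ e x) → Σ (inv x p ≢ e (inv x p)) λ q → u (inv x p) q ≡ u x p
    u-prod : ∀ x y (p : x ≢ e x) (q : y ≢ e y) →
             Σ (x · y ≢ e (x · y)) λ r → u (x · y) r ≡ u x p ⊎ u (x · y) r ≡ u y q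
    ≤-isTotalOrder : IsTotalOrder _≡_ _≤_
    ≤-+ : ∀ x y z → x ≤ y → x + z ≤ y + z
    ≤-absorbed : ∀ x y → y + e x ≡ e x → (y ≤ e x × - y ≤ e x)
    ≤-·-pos : ∀ x y z → e x < x → y ≤ z → x · y ≤ x · z
    ≤-·-mag : ∀ x y z → e y ≤ y → y ≤ z → e x · y ≤ e x · z
    mag-prod-mag : ∀ x y → ∃ λ z → e x · y ≡ e z
    e-prod : ∀ x y → e (x · y) ≡ e x · y + e y · x
    e-unity : ∀ x (p : x ≢ e x) → e (u x p) ≡ e x · inv x p
    distrib : ∀ x y z → x · y + x · z ≡ x · (y + z) + e x · y + e x · z
    neg-prod : ∀ x y → - (x · y) ≡ (- x) · y
    𝟘-identity : ∀ x → 𝟘 + x ≡ x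
    𝟙-identity : ∀ x → 𝟙 · x ≡ x
    M-max : ∀ x → e x + M ≡ M
    nontrivial : ∃ λ x → e x ≢ 𝟘 × e x ≢ M
    decomposition : ∀ x → ∃ λ a → x ≡ a + e x × e a ≡ 𝟘
    mag-dense : ∀ x y → x ≡ e x → y ≡ e y → x < y → ∃ λ z → z ≢ e z × x < z × z < y

{-# OPTIONS --safe #-}
-- If one factor is a magnitude, then so is the product, and xy = e(xy).
-- Otherwise e(x) < x and e(y) < y. Since e(xy) = e(x)y + e(y)x is a sum of two
-- magnitudes, it equals one of them, say e(y)x, and multiplying e(y) ≤ y by
-- the strictly positive x gives e(xy) = xe(y) ≤ xy.
module Submission where

open import Defs
open import Data.Product using (_,_)
open import Data.Sum using (_⊎_; inj₁; inj₂)
open import Relation.Binary.Definitions using (DecidableEquality)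
open import Relation.Binary.PropositionalEquality using (_≡_; refl; sym; ≢-sym; trans; cong; subst; subst₂)
open import Relation.Binary.Structures using (IsTotalOrder)
open import Relation.Nullary using (contradiction; yes; no)

-- Totality is a function into an untruncated sum: if x ≡ y, the answers on
-- (x , y) and (y , x) carry the same tag, so differing tags refute equality.
totalOrder⇒≟ : {A : Set} {_≤_ : A → A → Set} →
               IsTotalOrder _≡_ _≤_ → DecidableEquality A
totalOrder⇒≟ isTotal x y with IsTotalOrder.total isTotal x y in p | IsTotalOrder.total isTotal y x in q
... | inj₁ x≤y | inj₁ y≤x = yes (IsTotalOrder.antisym isTotal x≤y y≤x)
... | inj₂ y≤x | inj₂ x≤y = yes (IsTotalOrder.antisym isTotal x≤y y≤x)
... | inj₁ _   | inj₂ _   = no λ { refl → contradiction (trans (sym p) q) λ () }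
... | inj₂ _   | inj₁ _   = no λ { refl → contradiction (trans (sym p) q) λ () }

module _ (S : Solid) where
  open Solid S
  open IsTotalOrder ≤-isTotalOrder using () renaming (reflexive to ≤-reflexive)

  -- Allows a constructive case split on whether a factor is a magnitude.
  _≟_ : DecidableEquality Carrier
  _≟_ = totalOrder⇒≟ ≤-isTotalOrder

  -- Minimality makes `e x` neutral for itself; its own minimality condition is then a tautology, so
  -- uniqueness applies.
  e-idem : ∀ x → e (e x) ≡ e x
  e-idem x = sym (e-unique (e x) (e x) (e-minimal x (e x) (e-neutral x)) λ _ eq → eq)

  e-mag-prod : ∀ x y → e (e x · y) ≡ e x · y
  e-mag-prod x y with mag-prod-mag x y
  ... | z , eq = trans (cong e eq) (trans (e-idem z) (sym eq))

  mag⇒prod-mag : ∀ {x} y → x ≡ e x → e (x · y) ≡ x · y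
  mag⇒prod-mag {x} y x≡ex = subst (λ w → e (w · y) ≡ w · y) (sym x≡ex) (e-mag-prod x y)

  -- Apply `e` to both sides of `e-prod`: `e-sum` selects a summand, and both sides are fixed by
  -- `e`.
  e-prod-sel : ∀ x y → e (x · y) ≡ e x · y ⊎ e (x · y) ≡ e y · x
  e-prod-sel x y with e-sum (e x · y) (e y · x)
  ... | inj₁ eq = inj₁ (trans (sym (e-idem _)) (trans (cong e (e-prod x y)) (trans eq (e-mag-prod x y))))
  ... | inj₂ eq = inj₂ (trans (sym (e-idem _)) (trans (cong e (e-prod x y)) (trans eq (e-mag-prod y x))))

  mag-prod-≤ : ∀ x y → e x < x → e y ≤ y → e y · x ≤ x · y
  mag-prod-≤ x y ex<x ey≤y = subst (_≤ x · y) (·-comm x (e y)) (≤-·-pos x (e y) y ex<x ey≤y)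

  positive-· : ∀ x y → e x ≤ x → e y ≤ y → e (x · y) ≤ x · y
  positive-· x y ex≤x ey≤y with x ≟ e x | y ≟ e y
  ... | yes x≡ex | _ = ≤-reflexive (mag⇒prod-mag y x≡ex)
  ... | no _ | yes y≡ey = subst (λ w → e w ≤ w) (·-comm y x) (≤-reflexive (mag⇒prod-mag x y≡ey))
  ... | no x≢ex | no y≢ey with e-prod-sel x y
  -- Here `e x` is the factor to enlarge, so `y` is the strictly positive multiplier.
  ...   | inj₁ eq = subst₂ _≤_ (sym eq) (·-comm y x) (mag-prod-≤ y x (ey≤y , ≢-sym y≢ey) ex≤x)
  ...   | inj₂ eq = subst (_≤ x · y) (sym eq) (mag-prod-≤ x y (ex≤x , ≢-sym x≢ex) ey≤y)

theorem2p20 : (S : Solid) → let open Solid S in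
    ∀ x y → e x ≤ x → e y ≤ y → e (x · y) ≤ x · y
theorem2p20 = positive-·
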